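{- Let $G$ be a connected locally connected $(K_1+(K_1\cup K_2))$-free graph of order at least $3$. Then: (i) $G$ is weakly pancyclic. (ii) $G$ is fully cycle extendable if and only if $2\delta(G)\geq n(G)$.
   Context: All graphs are finite, simple, and undirected. $n(G)$ is the order (number of vertices) and $\delta(G)$ the minimum degree of $G$; $N_G(u)$ is the (open) neighborhood of $u$ in $G$. $G$ is locally connected if for every vertex $u$ of $G$ the induced subgraph $G[N_G(u)]$ is connected. For disjoint graphs $G,H$, $G\cup H$ is their disjoint union and $G+H$ their join (all edges between $G$ and $H$ are added to $G\cup H$); $K_n$ is the complete graph of order $n$. A graph is $F$-free if it does not contain $F$ as an induced subgraph (up to isomorphism). The girth $g(G)$ and circumference $c(G)$ are the minimum and maximum order of a cycle in $G$, respectively; $G$ is weakly pancyclic if it has a cycle of order $\ell$ for every integer $\ell$ with $g(G)\leq \ell\leq c(G)$. A cycle $C$ in $G$ is extendable if $G$ contains a cycle $C'$ of order $n(C)+1$ with $V(C)\subseteq V(C')$. $G$ is fully cycle extendable if every vertex of $G$ lies on a triangle and every cycle in $G$ of order less than $n(G)$ is extendable. -}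

module Defs where

open import Data.Bool using (Bool; true; false; not; T)
open import Data.Fin using (Fin; _≟_)
open import Data.Fin.Subset using (Subset; _∈_; ∣_∣)
open import Data.List using (List; _∷_; _∷ʳ_; length; map; allFin)
open import Data.List.Extrema.Nat using (min)
import Data.List.Membership.Propositional as List
open import Data.List.Relation.Binary.Subset.Propositional using (_⊆_)
open import Data.List.Relation.Unary.Linked using (Linked)
open import Data.List.Relation.Unary.Unique.Propositional using (Unique)
open import Data.Nat using (ℕ; suc; _≤_; _<_)
open import Data.Product using (Σ; ∃-syntax; _×_; proj₁)
open import Data.Sum using (_⊎_; inj₁; inj₂)
open import Data.Vec using (tabulate)
open import Function.Definitions using (Injective)
open import Relation.Binary.Construct.Closure.ReflexiveTransitive using (Star)
open import Relation.Binary.PropositionalEquality using (_≡_; refl; sym)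
open import Relation.Nullary using (¬_; yes; no; ⌊_⌋; contradiction)

-- A finite graph of order n is a `Graph (Fin n)`; other vertex types are
-- allowed so that induced subgraphs, unions and joins need no renumbering.
record Graph (V : Set) : Set where
  field
    adj      : V → V → Bool
    adj-sym  : ∀ u v → adj u v ≡ adj v u
    loopless : ∀ v → adj v v ≡ false

  infix 4 _~_
  _~_ : V → V → Set
  u ~ v = T (adj u v)

open Graph using (adj; adj-sym; loopless)

private
  ≟-sym : ∀ {n} (i j : Fin n) → not ⌊ i ≟ j ⌋ ≡ not ⌊ j ≟ i ⌋
  ≟-sym i j with i ≟ j | j ≟ i
  ... | yes _   | yes _   = refl
  ... | no _    | no _    = refl
  ... | yes i≡j | no j≢i  = contradiction (sym i≡j) j≢i
  ... | no i≢j  | yes j≡i = contradiction (sym j≡i) i≢j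

  ≟-diag : ∀ {n} (i : Fin n) → not ⌊ i ≟ i ⌋ ≡ false
  ≟-diag i with i ≟ i
  ... | yes _   = refl
  ... | no i≢i  = contradiction refl i≢i

K : ∀ n → Graph (Fin n)
K n = record
  { adj      = λ i j → not ⌊ i ≟ j ⌋
  ; adj-sym  = ≟-sym
  ; loopless = ≟-diag
  }

infixr 6 _∪ᴳ_ _+ᴳ_

_∪ᴳ_ : ∀ {V W : Set} → Graph V → Graph W → Graph (V ⊎ W)
_∪ᴳ_ {V} {W} G H = record { adj = a ; adj-sym = s ; loopless = l }
  where
  a : V ⊎ W → V ⊎ W → Bool
  a (inj₁ u) (inj₁ v) = adj G u v
  a (inj₁ _) (inj₂ _) = false
  a (inj₂ _) (inj₁ _) = false
  a (inj₂ u) (inj₂ v) = adj H u v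

  s : ∀ u v → a u v ≡ a v u
  s (inj₁ u) (inj₁ v) = adj-sym G u v
  s (inj₁ _) (inj₂ _) = refl
  s (inj₂ _) (inj₁ _) = refl
  s (inj₂ u) (inj₂ v) = adj-sym H u v

  l : ∀ v → a v v ≡ false
  l (inj₁ v) = loopless G v
  l (inj₂ v) = loopless H v

_+ᴳ_ : ∀ {V W : Set} → Graph V → Graph W → Graph (V ⊎ W)
_+ᴳ_ {V} {W} G H = record { adj = a ; adj-sym = s ; loopless = l }
  where
  a : V ⊎ W → V ⊎ W → Bool
  a (inj₁ u) (inj₁ v) = adj G u v
  a (inj₁ _) (inj₂ _) = true
  a (inj₂ _) (inj₁ _) = true
  a (inj₂ u) (inj₂ v) = adj H u v

  s : ∀ u v → a u v ≡ a v u
  s (inj₁ u) (inj₁ v) = adj-sym G u v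
  s (inj₁ _) (inj₂ _) = refl
  s (inj₂ _) (inj₁ _) = refl
  s (inj₂ u) (inj₂ v) = adj-sym H u v

  l : ∀ v → a v v ≡ false
  l (inj₁ v) = loopless G v
  l (inj₂ v) = loopless H v

-- F occurs in G as an induced subgraph, up to isomorphism.
_InducedIn_ : ∀ {V W : Set} → Graph V → Graph W → Set
_InducedIn_ {V} {W} F G =
  Σ (V → W) λ f → Injective _≡_ _≡_ f × (∀ u v → adj F u v ≡ adj G (f u) (f v))

_-Free_ : ∀ {V W : Set} → Graph V → Graph W → Set
F -Free G = ¬ (F InducedIn G)

-- Membership in a Subset is proof-irrelevant, so each vertex occurs once.
_[_] : ∀ {n} → Graph (Fin n) → (S : Subset n) → Graph (∃[ v ] v ∈ S)
G [ S ] = record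
  { adj      = λ u v → adj G (proj₁ u) (proj₁ v)
  ; adj-sym  = λ u v → adj-sym G (proj₁ u) (proj₁ v)
  ; loopless = λ v → loopless G (proj₁ v)
  }

-- The graph without vertices counts as connected.
Connected : ∀ {V : Set} → Graph V → Set
Connected G = ∀ u v → Star (Graph._~_ G) u v

N : ∀ {n} → Graph (Fin n) → Fin n → Subset n
N G u = tabulate (adj G u)

LocallyConnected : ∀ {n} → Graph (Fin n) → Set
LocallyConnected G = ∀ u → Connected (G [ N G u ])

degree : ∀ {n} → Graph (Fin n) → Fin n → ℕ
degree G u = ∣ N G u ∣

-- The first argument of min is its value on the empty list; it does not
-- affect the minimum when n > 0, every degree being less than n.
δ : ∀ {n} → Graph (Fin n) → ℕ
δ {n} G = min n (map (degree G) (allFin n))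

-- A cycle is given by a cyclic listing of its vertices from a chosen start.
record Cycle {V : Set} (G : Graph V) : Set where
  field
    start : V
    rest  : List V

  vertices : List V
  vertices = start ∷ rest

  order : ℕ
  order = length vertices

  field
    3≤order  : 3 ≤ order
    distinct : Unique vertices
    closed   : Linked (Graph._~_ G) (vertices ∷ʳ start)

open Cycle using (vertices; order)

HasCycle : ∀ {V : Set} → Graph V → ℕ → Set
HasCycle G ℓ = Σ (Cycle G) λ C → order C ≡ ℓ

IsGirth : ∀ {V : Set} → Graph V → ℕ → Set
IsGirth G g = HasCycle G g × (∀ ℓ → HasCycle G ℓ → g ≤ ℓ)

IsCircumference : ∀ {V : Set} → Graph V → ℕ → Set
IsCircumference G c = HasCycle G c × (∀ ℓ → HasCycle G ℓ → ℓ ≤ c)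

-- Holds vacuously for acyclic graphs, which have no girth or circumference.
WeaklyPancyclic : ∀ {V : Set} → Graph V → Set
WeaklyPancyclic G =
  ∀ g c → IsGirth G g → IsCircumference G c →
  ∀ ℓ → g ≤ ℓ → ℓ ≤ c → HasCycle G ℓ

Extendable : ∀ {V : Set} {G : Graph V} → Cycle G → Set
Extendable {G = G} C =
  Σ (Cycle G) λ C′ → order C′ ≡ suc (order C) × vertices C ⊆ vertices C′

OnTriangle : ∀ {V : Set} → Graph V → V → Set
OnTriangle G u = Σ (Cycle G) λ C → order C ≡ 3 × u List.∈ vertices C

FullyCycleExtendable : ∀ {n} → Graph (Fin n) → Set
FullyCycleExtendable {n} G =
  (∀ u → OnTriangle G u) × (∀ (C : Cycle G) → order C < n → Extendable C)

{-# OPTIONS --safe #-}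

-- Local connectedness turns every edge into an edge of a triangle, and then
-- paw-freeness makes non-adjacency transitive (G is complete multipartite with
-- at least three parts): every vertex is adjacent to an end of every edge.
--
-- (i) If v, v′, v″ are consecutive on a cycle and v ~ v″, then v′ can be
-- skipped.  If there is no such chord, the cycle alternates between two parts,
-- and a vertex of a third part can replace two consecutive vertices.
--
-- (ii) On a Hamiltonian cycle the successor of a non-neighbour of u is a
-- neighbour of u, so deg u ≥ n / 2.  Conversely, let w be outside a cycle C
-- that cannot be extended.  No two consecutive vertices of C are neighbours of
-- w, so at most half of C is adjacent to w, and the degree condition gives a
-- neighbour x of w outside C.  Applied to both w and x, this shows that no
-- vertex of C is adjacent to both, so the third vertex of a triangle on w x is
-- adjacent to all of C and extends C.
module Submission where

open import Defs
open import Data.Bool using (Bool; true; false; T)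
open import Data.Bool.Properties using (T-≡)
open import Data.Fin using (Fin; zero; suc)
open import Data.Fin.Properties using (_≟_; any?)
open import Data.Fin.Subset using (_∈_; ∣_∣)
open import Data.List using (List; []; _∷_; _∷ʳ_; _++_; length; filter; allFin)
import Data.List as List
open import Data.List.Extrema.Nat using (argmin-all; min≤xs)
import Data.List.Membership.DecPropositional as DecMembership
import Data.List.Membership.Propositional as List
open import Data.List.Membership.Propositional.Properties
  using (∈-allFin; ∈-∃++; ∈-filter⁺; ∈-filter⁻)
open import Data.List.Properties using (length-tabulate)
open import Data.List.Relation.Binary.Permutation.Propositional
  using (_↭_; prep; swap; ↭-refl; ↭-sym; ↭-trans; ↭⇒↭ₛ)
open import Data.List.Relation.Binary.Permutation.Propositional.Properties
  using (∈-resp-↭; ↭-length; shift; ∷↭∷ʳ; filter-↭)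
import Data.List.Relation.Binary.Permutation.Setoid.Properties as Permutationₛ
open import Data.List.Relation.Binary.Subset.Propositional using (_⊆_)
open import Data.List.Relation.Unary.All as All using (All; []; _∷_)
import Data.List.Relation.Unary.All.Properties as All
open import Data.List.Relation.Unary.AllPairs using ([]; _∷_)
open import Data.List.Relation.Unary.Any using (here; there)
open import Data.List.Relation.Unary.Linked as Linked using (Linked; [-]; _∷_)
open import Data.List.Relation.Unary.Unique.Propositional using (Unique)
import Data.List.Relation.Unary.Unique.Propositional.Properties as Unique
open import Data.Nat using (ℕ; zero; suc; _+_; _≤_; _<_; _≥_; _*_; z≤n; s≤s)
open import Data.Nat.Properties hiding (_≟_)
open import Data.Product using (_×_; _,_; ∃-syntax; ∃₂; proj₁; proj₂)
open import Data.Sum using (_⊎_; inj₁; inj₂; [_,_]′)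
import Data.Sum as Sum
import Data.Vec as Vec
open import Data.Vec.Properties using (lookup∘tabulate; []=⇒lookup; lookup⇒[]=)
open import Function using (_∘_; id; case_of_)
open import Function.Bundles using (_⇔_; mk⇔; Equivalence)
open import Relation.Binary.Construct.Closure.ReflexiveTransitive using (Star; ε; _◅_)
open import Relation.Binary.PropositionalEquality
  using (_≡_; _≢_; refl; sym; trans; cong; subst; setoid)
open import Relation.Nullary using (¬_; Dec; yes; no; contradiction; ¬?)
open import Relation.Nullary.Decidable using (T?; _×-dec_; decidable-stable)
open import Relation.Unary using (Decidable)

open Cycle using (vertices; order; 3≤order; distinct; closed)

private
  variable
    A : Set
    P Q : A → Set
    R : A → A → Set
    xs ys : List A

-- Counting in duplicate-free lists and along linked lists.

¬T⇒≡false : ∀ {b} → ¬ T b → b ≡ false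
¬T⇒≡false {false} _  = refl
¬T⇒≡false {true}  ¬t = contradiction _ ¬t

≡-or-step : ∀ {u v} → Star R u v → u ≡ v ⊎ ∃[ w ] R u w
≡-or-step ε       = inj₁ refl
≡-or-step (r ◅ _) = inj₂ (_ , r)

Unique-resp-↭ : xs ↭ ys → Unique xs → Unique ys
Unique-resp-↭ p = Permutationₛ.Unique-resp-↭ (setoid _) (↭⇒↭ₛ p)

Unique-⊆⇒length≤ : Unique xs → xs ⊆ ys → length xs ≤ length ys
Unique-⊆⇒length≤ []         _ = z≤n
Unique-⊆⇒length≤ {xs = x ∷ xs} (x# ∷ u) sub with ∈-∃++ (sub (here refl))
... | as , bs , refl = begin
  suc (length xs)           ≤⟨ s≤s (Unique-⊆⇒length≤ u sub′) ⟩
  suc (length (as ++ bs))   ≡⟨ ↭-length (shift x as bs) ⟨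
  length (as ++ x ∷ bs) ∎
  where
  open ≤-Reasoning
  sub′ : xs ⊆ as ++ bs
  sub′ v∈ with ∈-resp-↭ (shift x as bs) (sub (there v∈))
  ... | here v≡x = contradiction (sym v≡x) (All.lookup x# v∈)
  ... | there v∈′ = v∈′

length-filter+¬ : (P? : Decidable P) (xs : List A) →
  length xs ≡ length (filter P? xs) + length (filter (¬? ∘ P?) xs)
length-filter+¬ P? [] = refl
length-filter+¬ P? (x ∷ xs) with P? x
... | yes _ = cong suc (length-filter+¬ P? xs)
... | no  _ = trans (cong suc (length-filter+¬ P? xs)) (sym (+-suc _ _))

-- Stated for an arbitrary `f` so that the induction can pass to `f ∘ suc`; only `f = id` is needed
-- later.
∣tabulate∣≡length-filter : ∀ {m} (p : A → Bool) (f : Fin m → A) →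
  ∣ Vec.tabulate (p ∘ f) ∣ ≡ length (filter (T? ∘ p) (List.tabulate f))
∣tabulate∣≡length-filter {m = zero}  p f = refl
∣tabulate∣≡length-filter {m = suc m} p f with p (f zero)
... | true  = cong suc (∣tabulate∣≡length-filter p (f ∘ suc))
... | false = ∣tabulate∣≡length-filter p (f ∘ suc)

Linked⇒All : (∀ {x y} → R x y → P x) → ∀ a r b → Linked R (a ∷ r ∷ʳ b) → All P (a ∷ r)
Linked⇒All f a []      b (l ∷ _)  = f l ∷ []
Linked⇒All f a (c ∷ r) b (l ∷ ls) = f l ∷ Linked⇒All f c r b ls

-- Each entry satisfying `P` is charged to its successor, which satisfies `Q`. Distinct positions
-- have distinct successors, and the successors of `a ∷ r` are exactly `r ∷ʳ b`.
Linked⇒filter≤ : (P? : Decidable P) (Q? : Decidable Q) → ∀ a r b →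
  Linked (λ x y → P x → Q y) (a ∷ r ∷ʳ b) →
  length (filter P? (a ∷ r)) ≤ length (filter Q? (r ∷ʳ b))
Linked⇒filter≤ P? Q? a []      b (l ∷ _) with P? a | Q? b
... | yes p | yes _ = s≤s z≤n
... | yes p | no ¬q = contradiction (l p) ¬q
... | no  _ | _     = z≤n
Linked⇒filter≤ P? Q? a (c ∷ r) b (l ∷ ls) with ih ← Linked⇒filter≤ P? Q? c r b ls | P? a | Q? c
... | yes p | yes _ = s≤s ih
... | yes p | no ¬q = contradiction (l p) ¬q
... | no  _ | yes _ = m≤n⇒m≤1+n ih
... | no  _ | no _  = ih

-- On a closed list the successors are a rotation of the list itself, so both counts range over the
-- same entries.
cyclicLinked⇒filter≤ : (P? : Decidable P) (Q? : Decidable Q) → ∀ a r →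
  Linked (λ x y → P x → Q y) (a ∷ r ∷ʳ a) →
  length (filter P? (a ∷ r)) ≤ length (filter Q? (a ∷ r))
cyclicLinked⇒filter≤ P? Q? a r l = ≤-trans (Linked⇒filter≤ P? Q? a r a l)
  (≤-reflexive (↭-length (filter-↭ Q? (↭-sym (∷↭∷ʳ a r)))))

-- Neighbourhoods, degrees and the insertion of a vertex into a cycle.

module _ {n : ℕ} (G : Graph (Fin n)) where

  open Graph G
  open DecMembership (_≟_ {n}) using (_∈?_)

  private
    V : Set
    V = Fin n

  infix 4 _~?_
  _~?_ : ∀ u v → Dec (u ~ v)
  u ~? v = T? (adj u v)

  ~-sym : ∀ {u v} → u ~ v → v ~ u
  ~-sym {u} {v} = subst T (adj-sym u v)

  ~-irrefl : ∀ {u} → ¬ u ~ u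
  ~-irrefl {u} = subst T (loopless u)

  ~⇒≢ : ∀ {u v} → u ~ v → u ≢ v
  ~⇒≢ u~v refl = ~-irrefl u~v

  ∈N⇒~ : ∀ {u v} → v ∈ N G u → u ~ v
  ∈N⇒~ {u} {v} v∈ = Equivalence.from T-≡ (trans (sym (lookup∘tabulate (adj u) v)) ([]=⇒lookup v∈))

  ~⇒∈N : ∀ {u v} → u ~ v → v ∈ N G u
  ~⇒∈N {u} {v} u~v = lookup⇒[]= v _ (trans (lookup∘tabulate (adj u) v) (Equivalence.to T-≡ u~v))

  neighbours : V → List V
  neighbours u = filter (u ~?_) (allFin n)

  degree≡length-neighbours : ∀ u → degree G u ≡ length (neighbours u)
  degree≡length-neighbours u = ∣tabulate∣≡length-filter (adj u) id

  length-filter≤degree : ∀ u {xs} → Unique xs → length (filter (u ~?_) xs) ≤ degree G u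
  length-filter≤degree u {xs} uniq = ≤-trans
    (Unique-⊆⇒length≤ (Unique.filter⁺ (u ~?_) uniq)
      (λ v∈ → ∈-filter⁺ (u ~?_) (∈-allFin _) (proj₂ (∈-filter⁻ (u ~?_) {xs = xs} v∈))))
    (≤-reflexive (sym (degree≡length-neighbours u)))

  degree≤length-filter : ∀ u xs → (∀ v → u ~ v → v List.∈ xs) → degree G u ≤ length (filter (u ~?_) xs)
  degree≤length-filter u xs cover = ≤-trans
    (≤-reflexive (degree≡length-neighbours u))
    (Unique-⊆⇒length≤ (Unique.filter⁺ (u ~?_) (Unique.allFin⁺ n))
      (λ v∈ → let u~v = proj₂ (∈-filter⁻ (u ~?_) {xs = allFin n} v∈)
              in ∈-filter⁺ (u ~?_) (cover _ u~v) u~v))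

  δ≤degree : ∀ u → δ G ≤ degree G u
  δ≤degree u = All.lookup (All.map⁻ (min≤xs n (List.map (degree G) (allFin n)))) (∈-allFin u)

  length<n⇒∃∉ : ∀ xs → length xs < n → ∃[ v ] ¬ v List.∈ xs
  length<n⇒∃∉ xs short with any? (λ v → ¬? (v ∈? xs))
  ... | yes found = found
  ... | no  none  = contradiction short (≤⇒≯ (≤-trans
    (≤-reflexive (sym (length-tabulate id)))
    (Unique-⊆⇒length≤ (Unique.allFin⁺ n)
      (λ {v} _ → decidable-stable (v ∈? xs) (λ v∉ → none (v , v∉))))))

  -- The vertex `w` fits between the first two consecutive vertices that are both its neighbours.
  -- The ends `a` and `b` stay in place, so that `a = b` gives the case of a cycle.
  insert-or-separated : ∀ w a r b → Linked _~_ (a ∷ r ∷ʳ b) →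
    (∃[ r′ ] r′ ↭ w ∷ r × Linked _~_ (a ∷ r′ ∷ʳ b)) ⊎
    Linked (λ x y → ¬ (w ~ x × w ~ y)) (a ∷ r ∷ʳ b)
  insert-or-separated w a []      b (a~b ∷ _) with (w ~? a) ×-dec (w ~? b)
  ... | yes (w~a , w~b) = inj₁ (w ∷ [] , ↭-refl , ~-sym w~a ∷ w~b ∷ [-])
  ... | no  ¬both       = inj₂ (¬both ∷ [-])
  insert-or-separated w a (c ∷ r) b (a~c ∷ l) with (w ~? a) ×-dec (w ~? c)
  ... | yes (w~a , w~c) = inj₁ (w ∷ c ∷ r , ↭-refl , ~-sym w~a ∷ w~c ∷ l)
  ... | no  ¬both with insert-or-separated w c r b l
  ...   | inj₁ (r′ , p , l′) = inj₁ (c ∷ r′ , ↭-trans (prep c p) (swap c w ↭-refl) , a~c ∷ l′)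
  ...   | inj₂ sep           = inj₂ (¬both ∷ sep)

  insert⇒Extendable : ∀ (C : Cycle G) {w r′} → ¬ w List.∈ vertices C →
    r′ ↭ w ∷ Cycle.rest C → Linked _~_ (Cycle.start C ∷ r′ ∷ʳ Cycle.start C) → Extendable C
  insert⇒Extendable C {w} {r′} w∉ p l =
    record
      { start    = start
      ; rest     = r′
      ; 3≤order  = ≤-trans (3≤order C) (≤-trans (n≤1+n _) (≤-reflexive (sym (↭-length q))))
      ; distinct = Unique-resp-↭ (↭-sym q) (All.¬Any⇒All¬ _ w∉ ∷ distinct C)
      ; closed   = l
      }
    , ↭-length q
    , ∈-resp-↭ (↭-sym q) ∘ there
    where
    open Cycle C using (start)
    q : start ∷ r′ ↭ w ∷ vertices C
    q = ↭-trans (prep start p) (swap start w ↭-refl)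

  extend-or-separated : ∀ (C : Cycle G) w → ¬ w List.∈ vertices C →
    Extendable C ⊎ Linked (λ x y → ¬ (w ~ x × w ~ y)) (vertices C ∷ʳ Cycle.start C)
  extend-or-separated C w w∉ with insert-or-separated w _ _ _ (closed C)
  ... | inj₁ (r′ , p , l) = inj₁ (insert⇒Extendable C w∉ p l)
  ... | inj₂ sep          = inj₂ sep

  -- Paw-freeness and local connectedness: every edge dominates the graph.

  private
    Paw-Free : Set
    Paw-Free = (K 1 +ᴳ (K 1 ∪ᴳ K 2)) -Free G

  -- Otherwise the triangle `x`, `y`, `t` with `z` pendant at `x` is an induced paw: `x` is the
  -- vertex joined to everything, `z` the isolated vertex, and `y`, `t` span the `K 2`.
  paw-free⇒ : Paw-Free → ∀ {x y t z} → x ~ y → x ~ t → y ~ t → x ~ z → z ~ y ⊎ z ~ t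
  paw-free⇒ free {x} {y} {t} {z} x~y x~t y~t x~z with z ~? y | z ~? t
  ... | yes z~y | _       = inj₁ z~y
  ... | no  _   | yes z~t = inj₂ z~t
  ... | no z≁y  | no z≁t  = contradiction (f , (λ {u v} → f-inj {u} {v}) , f-adj) free
    where
    W : Set
    W = Fin 1 ⊎ (Fin 1 ⊎ Fin 2)

    f : W → V
    f (inj₁ zero)              = x
    f (inj₂ (inj₁ zero))       = z
    f (inj₂ (inj₂ zero))       = y
    f (inj₂ (inj₂ (suc zero))) = t

    -- Distinctness comes from the non-adjacencies: if `z` were `y`, it would be adjacent to `t`,
    -- and symmetrically.
    z≢y : z ≢ y
    z≢y refl = z≁t y~t

    z≢t : z ≢ t
    z≢t refl = z≁y (~-sym y~t)

    f-inj : ∀ {u v} → f u ≡ f v → u ≡ v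
    f-inj {inj₁ zero} {inj₁ zero} _ = refl
    f-inj {inj₁ zero} {inj₂ (inj₁ zero)} e = contradiction e (~⇒≢ x~z)
    f-inj {inj₁ zero} {inj₂ (inj₂ zero)} e = contradiction e (~⇒≢ x~y)
    f-inj {inj₁ zero} {inj₂ (inj₂ (suc zero))} e = contradiction e (~⇒≢ x~t)
    f-inj {inj₂ (inj₁ zero)} {inj₁ zero} e = contradiction (sym e) (~⇒≢ x~z)
    f-inj {inj₂ (inj₁ zero)} {inj₂ (inj₁ zero)} _ = refl
    f-inj {inj₂ (inj₁ zero)} {inj₂ (inj₂ zero)} e = contradiction e z≢y
    f-inj {inj₂ (inj₁ zero)} {inj₂ (inj₂ (suc zero))} e = contradiction e z≢t
    f-inj {inj₂ (inj₂ zero)} {inj₁ zero} e = contradiction (sym e) (~⇒≢ x~y)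
    f-inj {inj₂ (inj₂ zero)} {inj₂ (inj₁ zero)} e = contradiction (sym e) z≢y
    f-inj {inj₂ (inj₂ zero)} {inj₂ (inj₂ zero)} _ = refl
    f-inj {inj₂ (inj₂ zero)} {inj₂ (inj₂ (suc zero))} e = contradiction e (~⇒≢ y~t)
    f-inj {inj₂ (inj₂ (suc zero))} {inj₁ zero} e = contradiction (sym e) (~⇒≢ x~t)
    f-inj {inj₂ (inj₂ (suc zero))} {inj₂ (inj₁ zero)} e = contradiction (sym e) z≢t
    f-inj {inj₂ (inj₂ (suc zero))} {inj₂ (inj₂ zero)} e = contradiction (sym e) (~⇒≢ y~t)
    f-inj {inj₂ (inj₂ (suc zero))} {inj₂ (inj₂ (suc zero))} _ = refl

    edge : ∀ {u v} → u ~ v → true ≡ adj u v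
    edge = sym ∘ Equivalence.to T-≡

    nonedge : ∀ {u v} → ¬ u ~ v → false ≡ adj u v
    nonedge = sym ∘ ¬T⇒≡false

    f-adj : ∀ u v → Graph.adj (K 1 +ᴳ (K 1 ∪ᴳ K 2)) u v ≡ adj (f u) (f v)
    f-adj (inj₁ zero) (inj₁ zero) = nonedge ~-irrefl
    f-adj (inj₁ zero) (inj₂ (inj₁ zero)) = edge x~z
    f-adj (inj₁ zero) (inj₂ (inj₂ zero)) = edge x~y
    f-adj (inj₁ zero) (inj₂ (inj₂ (suc zero))) = edge x~t
    f-adj (inj₂ (inj₁ zero)) (inj₁ zero) = edge (~-sym x~z)
    f-adj (inj₂ (inj₁ zero)) (inj₂ (inj₁ zero)) = nonedge ~-irrefl
    f-adj (inj₂ (inj₁ zero)) (inj₂ (inj₂ zero)) = nonedge z≁y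
    f-adj (inj₂ (inj₁ zero)) (inj₂ (inj₂ (suc zero))) = nonedge z≁t
    f-adj (inj₂ (inj₂ zero)) (inj₁ zero) = edge (~-sym x~y)
    f-adj (inj₂ (inj₂ zero)) (inj₂ (inj₁ zero)) = nonedge (z≁y ∘ ~-sym)
    f-adj (inj₂ (inj₂ zero)) (inj₂ (inj₂ zero)) = nonedge ~-irrefl
    f-adj (inj₂ (inj₂ zero)) (inj₂ (inj₂ (suc zero))) = edge y~t
    f-adj (inj₂ (inj₂ (suc zero))) (inj₁ zero) = edge (~-sym x~t)
    f-adj (inj₂ (inj₂ (suc zero))) (inj₂ (inj₁ zero)) = nonedge (z≁t ∘ ~-sym)
    f-adj (inj₂ (inj₂ (suc zero))) (inj₂ (inj₂ zero)) = edge (~-sym y~t)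
    f-adj (inj₂ (inj₂ (suc zero))) (inj₂ (inj₂ (suc zero))) = nonedge ~-irrefl

  -- The first step of a path from `y` to `z` inside the neighbourhood of `x` leads to `t`.
  commonNeighbour : LocallyConnected G → ∀ {x y z} → x ~ y → x ~ z → y ≢ z →
    ∃[ t ] x ~ t × y ~ t
  commonNeighbour loc {x} x~y x~z y≢z with ≡-or-step (loc x (_ , ~⇒∈N x~y) (_ , ~⇒∈N x~z))
  ... | inj₁ eq               = contradiction (cong proj₁ eq) y≢z
  ... | inj₂ ((t , t∈) , y~t) = t , ∈N⇒~ t∈ , y~t

  neighbour : 3 ≤ n → Connected G → ∀ u → ∃[ v ] u ~ v
  neighbour 3≤n conn u with length<n⇒∃∉ (u ∷ []) (≤-trans (n≤1+n 2) 3≤n)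
  ... | v , v∉ with ≡-or-step (conn u v)
  ...   | inj₁ u≡v  = contradiction (here (sym u≡v)) v∉
  ...   | inj₂ step = step

  -- The set of vertices adjacent to `x` or `y` contains `x` and is closed under adjacency, so a
  -- walk from `x` never leaves it.
  dominating-edge : Connected G → LocallyConnected G → Paw-Free →
    ∀ {x y} → x ~ y → ∀ z → z ~ x ⊎ z ~ y
  dominating-edge conn loc free {x} {y} x~y z = walk (conn x z) (inj₂ x~y)
    where
    from-x : ∀ {x y z w} → x ~ y → z ~ x → z ~ w → w ~ x ⊎ w ~ y
    from-x {x} {y} {z} {w} x~y z~x z~w with z ≟ y | z ~? y
    ... | yes refl | _ = inj₂ (~-sym z~w)
    ... | no _ | yes z~y = paw-free⇒ free z~x z~y x~y z~w
    -- With `z` not adjacent to `y`, the triangle `x`, `y`, `t` forces `z ~ t`. Then the triangle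
    -- `z`, `x`, `t` gives `w ~ x` or `w ~ t`, and in the latter case the triangle `t`, `x`, `y`
    -- finishes.
    ... | no z≢y | no z≁y with commonNeighbour loc x~y (~-sym z~x) (z≢y ∘ sym)
    ...   | t , x~t , y~t with paw-free⇒ free x~y x~t y~t (~-sym z~x)
    ...     | inj₁ z~y = contradiction z~y z≁y
    ...     | inj₂ z~t with paw-free⇒ free z~x z~t x~t z~w
    ...       | inj₁ w~x = inj₁ w~x
    ...       | inj₂ w~t = paw-free⇒ free (~-sym x~t) (~-sym y~t) x~y (~-sym w~t)

    walk : ∀ {u v} → Star _~_ u v → u ~ x ⊎ u ~ y → v ~ x ⊎ v ~ y
    walk ε          d = d
    walk (u~w ◅ p) (inj₁ u~x) = walk p (from-x x~y u~x u~w)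
    walk (u~w ◅ p) (inj₂ u~y) = walk p (Sum.swap (from-x (~-sym x~y) u~y u~w))

  -- Complete multipartite graphs: shortening cycles.

  module Multipartite
    (dominates : ∀ {x y} → x ~ y → ∀ z → z ~ x ⊎ z ~ y)
    (triangle  : ∀ {x y} → x ~ y → ∃[ t ] t ~ x × t ~ y)
    where

    -- In the first case `y` is the vertex skipped by a chord. In the second, all vertices lie in
    -- the parts of `a` and `c`, which is expressed by having no common neighbour of `a` and `c` on
    -- the path.
    shortcut-or-alternating : ∀ a c r b → Linked _~_ (a ∷ c ∷ r ∷ʳ b) →
      (∃₂ λ y r′ → c ∷ r ↭ y ∷ r′ × Linked _~_ (a ∷ r′ ∷ʳ b)) ⊎
      All (λ x → ¬ (x ~ a × x ~ c)) (a ∷ c ∷ r ∷ʳ b)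
    shortcut-or-alternating a c [] b (_ ∷ _ ∷ [-]) with a ~? b
    ... | yes a~b = inj₁ (c , [] , ↭-refl , a~b ∷ [-])
    ... | no  a≁b = inj₂ (~-irrefl ∘ proj₁ ∷ ~-irrefl ∘ proj₂ ∷ a≁b ∘ ~-sym ∘ proj₁ ∷ [])
    shortcut-or-alternating a c (d ∷ r) b (a~c ∷ c~d ∷ l) with a ~? d
    ... | yes a~d = inj₁ (c , d ∷ r , ↭-refl , a~d ∷ l)
    ... | no  a≁d with shortcut-or-alternating c d r b (c~d ∷ l)
    ...   | inj₁ (y , r′ , p , l′) =
      inj₁ (y , c ∷ r′ , ↭-trans (prep c p) (swap c y ↭-refl) , a~c ∷ l′)
    ...   | inj₂ alt = inj₂ (~-irrefl ∘ proj₁ ∷ All.map transfer alt)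
      where
      -- Since `a` and `d` are not adjacent they share a part, so a neighbour of `a` is a neighbour
      -- of `d`.
      transfer : ∀ {x} → ¬ (x ~ c × x ~ d) → ¬ (x ~ a × x ~ c)
      transfer ¬cd (x~a , x~c) with dominates x~a d
      ... | inj₁ d~x = ¬cd (x~c , ~-sym d~x)
      ... | inj₂ d~a = a≁d (~-sym d~a)

    shrink : ∀ {k} → 3 ≤ k → HasCycle G (suc k) → HasCycle G k
    shrink (s≤s (s≤s (s≤s _)))
      (record { start = s ; rest = c ∷ d ∷ e ∷ r ; distinct = u ; closed = l } , refl)
      with shortcut-or-alternating s c (d ∷ e ∷ r) s l
    ... | inj₁ (y , r′ , p , l′) =
      record
        { start    = s
        ; rest     = r′
        ; 3≤order  = ≤-trans (s≤s (s≤s (s≤s z≤n))) (≤-reflexive (↭-length p))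
        ; distinct = case Unique-resp-↭ (↭-trans (prep s p) (swap s y ↭-refl)) u of λ { (_ ∷ u′) → u′ }
        ; closed   = l′
        }
      , sym (↭-length p)
    -- The vertex `t` is adjacent to both `s` and `c`, which no vertex of the cycle is; hence `t` is
    -- new. It replaces `c` and `d`, for which `t ~ e` is required.
    ... | inj₂ alt with triangle (Linked.head l)
    ...   | t , t~s , t~c
      with u | All.map (λ {x} ¬sc (t≡x : t ≡ x) → ¬sc (subst (_~ s) t≡x t~s , subst (_~ c) t≡x t~c)) alt
         | l
    ...     | (_ ∷ _ ∷ s≢e ∷ s#) ∷ _ ∷ _ ∷ u′ | t≢s ∷ _ ∷ _ ∷ t≢e ∷ t# | _ ∷ _ ∷ _ ∷ l′ =
      record
        { start    = s
        ; rest     = t ∷ e ∷ r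
        ; 3≤order  = s≤s (s≤s (s≤s z≤n))
        ; distinct = (t≢s ∘ sym ∷ s≢e ∷ s#) ∷ (t≢e ∷ All.++⁻ˡ r t#) ∷ u′
        ; closed   = ~-sym t~s ∷ t~e ∷ l′
        }
      , refl
      where
      ¬both : ¬ (e ~ s × e ~ c)
      ¬both = All.lookup alt (there (there (there (here refl))))

      t~e : t ~ e
      t~e with dominates t~s e | dominates t~c e
      ... | inj₁ e~t | _        = ~-sym e~t
      ... | inj₂ _   | inj₁ e~t = ~-sym e~t
      ... | inj₂ e~s | inj₂ e~c = contradiction (e~s , e~c) ¬both

    shrink* : ∀ {ℓ} k → 3 ≤ ℓ → HasCycle G (k + ℓ) → HasCycle G ℓ
    shrink* zero    _   C = C
    shrink* (suc k) 3≤ℓ C = shrink* k 3≤ℓ (shrink (≤-trans 3≤ℓ (m≤n+m _ k)) C)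

    -- A longest cycle is shrunk one vertex at a time; the girth supplies `3 ≤ ℓ`.
    weaklyPancyclic : WeaklyPancyclic G
    weaklyPancyclic g c ((C , refl) , _) (Cc , _) ℓ g≤ℓ ℓ≤c =
      shrink* _ (≤-trans (3≤order C) g≤ℓ) (subst (HasCycle G) (sym (m∸n+n≡m ℓ≤c)) Cc)

    -- Full cycle extendability and the degree condition.

    onTriangle : ∀ {u v} → u ~ v → OnTriangle G u
    onTriangle {u} {v} u~v with triangle u~v
    ... | t , t~u , t~v =
      record
        { start    = u
        ; rest     = v ∷ t ∷ []
        ; 3≤order  = ≤-refl
        ; distinct = (~⇒≢ u~v ∷ ~⇒≢ (~-sym t~u) ∷ []) ∷ (~⇒≢ (~-sym t~v) ∷ []) ∷ [] ∷ []
        ; closed   = u~v ∷ ~-sym t~v ∷ t~u ∷ [-]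
        }
      , refl , here refl

    hamiltonian⇒n≤2*degree : HasCycle G n → ∀ u → n ≤ 2 * degree G u
    hamiltonian⇒n≤2*degree (C , |C|≡n) u = begin
      n                                                            ≡⟨ |C|≡n ⟨
      order C                                                      ≡⟨ length-filter+¬ (u ~?_) vs ⟩
      length (filter (u ~?_) vs) + length (filter (¬? ∘ (u ~?_)) vs) ≤⟨ +-monoʳ-≤ _ non≤nbr ⟩
      length (filter (u ~?_) vs) + length (filter (u ~?_) vs)       ≤⟨ +-mono-≤ nbr≤deg nbr≤deg ⟩
      degree G u + degree G u                                      ≡⟨ cong (degree G u +_) (+-identityʳ _) ⟨
      2 * degree G u                                               ∎
      where
      open ≤-Reasoning
      vs = vertices C
      nbr≤deg = length-filter≤degree u (distinct C)
      -- Every cycle edge has an end adjacent to `u`; `u` itself counts among the non-neighbours.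
      non≤nbr = cyclicLinked⇒filter≤ (¬? ∘ (u ~?_)) (u ~?_) _ _
        (Linked.map (λ x~y u≁x → [ (λ u~x → contradiction u~x u≁x) , id ]′ (dominates x~y u)) (closed C))

    -- A triangle through the given vertex is extended `n - 3` times.
    fullyExtendable⇒hamiltonian : V → 3 ≤ n → FullyCycleExtendable G → HasCycle G n
    fullyExtendable⇒hamiltonian u 3≤n (tri , ext) =
      subst (HasCycle G) (m∸n+n≡m 3≤n) (grow _ (≤-reflexive (m∸n+n≡m 3≤n)))
      where
      grow : ∀ k → k + 3 ≤ n → HasCycle G (k + 3)
      grow zero    _ with tri u
      ... | C , eq , _ = C , eq
      grow (suc k) k<n with grow k (<⇒≤ k<n)
      ... | C , |C|≡k with ext C (subst (_< n) (sym |C|≡k) k<n)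
      ...   | C′ , |C′|≡ , _ = C′ , trans |C′|≡ (cong suc |C|≡k)

    -- If all neighbours of `w` were on `C`, their successors would be as many non-neighbours on
    -- `C`, whence `2 * degree G w ≤ order C < n`.
    outerNeighbour : (C : Cycle G) → order C < n → ∀ w → n ≤ 2 * degree G w →
      Linked (λ x y → ¬ (w ~ x × w ~ y)) (vertices C ∷ʳ Cycle.start C) →
      ∃[ x ] w ~ x × ¬ x List.∈ vertices C
    outerNeighbour C short w deg sep with any? (λ x → (w ~? x) ×-dec ¬? (x ∈? vertices C))
    ... | yes found = found
    ... | no  none  = contradiction short (≤⇒≯ (begin
      n                                                            ≤⟨ deg ⟩
      2 * degree G w                                               ≡⟨ cong (degree G w +_) (+-identityʳ _) ⟩
      degree G w + degree G w                                      ≤⟨ +-mono-≤ deg≤nbr (≤-trans deg≤nbr nbr≤non) ⟩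
      length (filter (w ~?_) vs) + length (filter (¬? ∘ (w ~?_)) vs) ≡⟨ length-filter+¬ (w ~?_) vs ⟨
      order C                                                      ∎))
      where
      open ≤-Reasoning
      vs = vertices C
      deg≤nbr = degree≤length-filter w vs
        (λ v w~v → decidable-stable (v ∈? vs) (λ v∉ → none (v , w~v , v∉)))
      nbr≤non = cyclicLinked⇒filter≤ (w ~?_) (¬? ∘ (w ~?_)) _ _
        (Linked.map (λ ¬both w~x w~y → ¬both (w~x , w~y)) sep)

    separated-edge⇒Extendable : (C : Cycle G) → ∀ {w x} → w ~ x →
      Linked (λ a b → ¬ (w ~ a × w ~ b)) (vertices C ∷ʳ Cycle.start C) →
      Linked (λ a b → ¬ (x ~ a × x ~ b)) (vertices C ∷ʳ Cycle.start C) →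
      Extendable C
    separated-edge⇒Extendable C {w} {x} w~x sepʷ sepˣ = extend (triangle w~x)
      where
      extend : ∃[ z ] z ~ w × z ~ x → Extendable C
      extend (z , z~w , z~x) = insert C joined
        where
        -- If `a` missed `z`, the edges `z w` and `z x` would make it adjacent to both `w` and `x`.
        -- Its successor `b` is adjacent to one of these, against the separation.
        ¬both⇒~z : ∀ {a b} → ¬ (w ~ a × w ~ b) × ¬ (x ~ a × x ~ b) → a ~ z
        ¬both⇒~z {a} {b} (¬w , ¬x) with dominates z~w a | dominates z~x a
        ... | inj₁ a~z | _        = a~z
        ... | inj₂ _   | inj₁ a~z = a~z
        ... | inj₂ a~w | inj₂ a~x with dominates w~x b
        ...   | inj₁ b~w = contradiction (~-sym a~w , ~-sym b~w) ¬w
        ...   | inj₂ b~x = contradiction (~-sym a~x , ~-sym b~x) ¬x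

        joined : All (_~ z) (vertices C)
        joined = Linked⇒All ¬both⇒~z _ _ _ (Linked.zip (sepʷ , sepˣ))

        insert : (C : Cycle G) → All (_~ z) (vertices C) → Extendable C
        insert record { rest = [] ; 3≤order = s≤s () } _
        -- The vertex `z` is off the cycle, since otherwise it would be adjacent to itself; it goes
        -- right after the start.
        insert C@(record { rest = c ∷ r ; closed = _ ∷ l }) all@(s~z ∷ c~z ∷ _) =
          insert⇒Extendable C (λ z∈ → ~-irrefl (All.lookup all z∈)) ↭-refl (s~z ∷ ~-sym c~z ∷ l)

    extendable : (∀ u → n ≤ 2 * degree G u) → (C : Cycle G) → order C < n → Extendable C
    extendable deg C short with length<n⇒∃∉ (vertices C) short
    ... | w , w∉ with extend-or-separated C w w∉
    ...   | inj₁ ext = ext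
    ...   | inj₂ sepʷ with outerNeighbour C short w (deg w) sepʷ
    ...     | x , w~x , x∉ with extend-or-separated C x x∉
    ...       | inj₁ ext  = ext
    ...       | inj₂ sepˣ = separated-edge⇒Extendable C w~x sepʷ sepˣ

  n≤2*degree⇒n≤2*δ : (∀ u → n ≤ 2 * degree G u) → n ≤ 2 * δ G
  -- The default value `n` of the minimum in `δ` must satisfy the bound too: `n ≤ 2 * n`.
  n≤2*degree⇒n≤2*δ deg = argmin-all id {P = λ k → n ≤ 2 * k} (m≤m+n n _)
    (All.map⁺ (All.universal deg (allFin n)))

theorem3 : ∀ (n : ℕ) (G : Graph (Fin n)) →
    3 ≤ n →
    Connected G →
    LocallyConnected G →
    (K 1 +ᴳ (K 1 ∪ᴳ K 2)) -Free G →
    WeaklyPancyclic G × (FullyCycleExtendable G ⇔ 2 * δ G ≥ n)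
theorem3 n@(suc _) G 3≤n conn loc free = weaklyPancyclic , mk⇔ to from
  where
  open Graph G

  dominates : ∀ {x y} → x ~ y → ∀ z → z ~ x ⊎ z ~ y
  dominates = dominating-edge G conn loc free

  triangle : ∀ {x y} → x ~ y → ∃[ t ] t ~ x × t ~ y
  -- A third vertex `z` is adjacent to one end of the edge; that end then has two distinct
  -- neighbours, as `commonNeighbour` requires.
  triangle {x} {y} x~y with length<n⇒∃∉ G (x ∷ y ∷ []) 3≤n
  ... | z , z∉ with dominates x~y z
  ...   | inj₁ z~x with commonNeighbour G loc x~y (~-sym G z~x) (λ { refl → z∉ (there (here refl)) })
  ...     | t , x~t , y~t = t , ~-sym G x~t , ~-sym G y~t
  triangle {x} {y} x~y | z , z∉ | inj₂ z~y
    with commonNeighbour G loc (~-sym G x~y) (~-sym G z~y) (λ { refl → z∉ (here refl) })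
  ...     | t , y~t , x~t = t , ~-sym G x~t , ~-sym G y~t

  open Multipartite G dominates triangle

  to : FullyCycleExtendable G → 2 * δ G ≥ n
  -- Matching `n` as a successor makes `zero` available as the vertex of the initial triangle.
  to fce = n≤2*degree⇒n≤2*δ G (hamiltonian⇒n≤2*degree (fullyExtendable⇒hamiltonian zero 3≤n fce))

  from : 2 * δ G ≥ n → FullyCycleExtendable G
  from n≤2δ =
    (λ u → onTriangle (proj₂ (neighbour G 3≤n conn u)))
    , extendable (λ u → ≤-trans n≤2δ (*-monoʳ-≤ 2 (δ≤degree G u)))
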